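{- Let $M$ be a matroid on a ground set $S$, and let $A$ be a matroidal Latin square of degree $n$ over $M$. Then $A$ contains an independent partial transversal of size $\lceil 2n/3\rceil$.
   Context: A matroidal Latin square (MLS) of degree $n$ over a matroid $M$ with ground set $S$ is an $n\times n$ matrix $A$ whose entries are elements of $S$, where each row and each column of $A$ is a base of $M$ (so the $n$ entries of any single row or column are distinct, and $M$ has rank $n$; the same element of $S$ may occur in several cells of $A$ that lie in different rows and columns). An independent partial transversal of $A$ is an independent subset of entries of $A$, no two of which lie in the same row or column of $A$; its size is the number of its elements. That is, an independent partial transversal of size $k$ is given by $k$ cells, no two in the same row or column, whose entries are $k$ distinct elements of $S$ forming an independent set of $M$.
   Formalization: The degree n = 2 is excluded, since the claim fails there: over the free matroid on {0,1} the square with rows (0,1) and (1,0) has no independent partial transversal of size 2. The ground set is finite and independence is taken to be decidable. -}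

module Defs where

open import Data.Fin.Base using (Fin)
open import Data.Fin.Subset using (Subset; ⊥; ⁅_⁆; _∈_; _∉_; _⊆_; _∪_; ⋃; ∣_∣)
open import Data.List.Base using (tabulate)
open import Data.Nat.Base using (ℕ; pred; _+_; _<_; NonZero)
open import Data.Nat.DivMod using (_/_)
open import Data.Product.Base using (_×_; ∃-syntax)
open import Data.Vec.Functional using (Vector; transpose)
open import Function.Definitions using (Injective)
open import Level using (0ℓ)
open import Relation.Binary.PropositionalEquality.Core using (_≡_)
open import Relation.Unary using (Pred; Decidable)

⌈_/_⌉ : (a d : ℕ) .{{_ : NonZero d}} → ℕ
⌈ a / d ⌉ = (a + pred d) / d

-- The finite ground set S is Fin m. Decidability of independence is
-- automatic in classical logic; here it must be given as data.
record Matroid (m : ℕ) : Set₁ where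
  field
    Indep      : Pred (Subset m) 0ℓ
    indep?     : Decidable Indep
    indep-⊥    : Indep ⊥
    hereditary : ∀ {I J} → I ⊆ J → Indep J → Indep I
    augment    : ∀ {I J} → Indep I → Indep J → ∣ I ∣ < ∣ J ∣ →
                 ∃[ x ] (x ∈ J × x ∉ I × Indep (I ∪ ⁅ x ⁆))

  IsBase : Pred (Subset m) 0ℓ
  IsBase B = Indep B × (∀ {J} → Indep J → B ⊆ J → J ⊆ B)

entries : ∀ {m k} → Vector (Fin m) k → Subset m
entries v = ⋃ (tabulate λ i → ⁅ v i ⁆)

module _ {m : ℕ} (M : Matroid m) where
  open Matroid M

  -- Distinctness of the entries is required separately because `entries`
  -- forgets repetitions.
  IndepFamily : ∀ {k} → Vector (Fin m) k → Set
  IndepFamily v = Injective _≡_ _≡_ v × Indep (entries v)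

  BaseFamily : ∀ {k} → Vector (Fin m) k → Set
  BaseFamily v = Injective _≡_ _≡_ v × IsBase (entries v)

  record IsMLS {n : ℕ} (A : Vector (Vector (Fin m) n) n) : Set where
    field
      rows    : ∀ i → BaseFamily (A i)
      columns : ∀ j → BaseFamily (transpose A j)

  -- The cells used are (row t , col t) for t : Fin k.
  record IndepPartialTransversal
         {n : ℕ} (A : Vector (Vector (Fin m) n) n) (k : ℕ) : Set where
    field
      row         : Fin k → Fin n
      col         : Fin k → Fin n
      row-inj     : Injective _≡_ _≡_ row
      col-inj     : Injective _≡_ _≡_ col
      independent : IndepFamily (λ t → A (row t) (col t))

{-# OPTIONS --safe #-}
-- Let T be a partial transversal with entries V and 3|T| < 2n, and let k = n − |T| > |T|/2 be
-- the number of free rows and of free columns. Extending V to a base inside a free row r uses k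
-- entries of r, each independent of V. If one lies in a free column, it extends T. Otherwise at
-- least k cells d of T are swappable: the entry y of r in the column of d is independent of V.
-- The remaining fewer than k entries of T are augmented by the entry x of another free row r′ in
-- some free column, and then by members of V to an independent J of size |T| that omits the
-- entry of a single, swappable, cell d. Since V + y is larger than J, either J + y is
-- independent, and T − d plus the two new cells is a larger transversal, or V + x is
-- independent and x extends T. A second free row r′ is missing only for k = 1, when n = 2.
module Submission where

open import Defs
open import Data.Fin.Base using (Fin; zero; suc)
open import Data.Fin.Properties using (_≟_)
open import Data.Fin.Subset as Subset using (Subset; inside; outside; ⁅_⁆; ⋃; ∣_∣; _∪_)
open import Data.Fin.Subset.Properties
  using (x∈⁅x⁆; x∈⁅y⁆⇒x≡y; x∈p∪q⁺; x∈p∪q⁻; ∉⊥; ∣⊥∣≡0; p⊂q⇒∣p∣<∣q∣; q⊆p∪q; ∣⁅x⁆∣≡1; ∪-comm)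
open import Data.List.Base
  using (List; []; _∷_; _++_; map; length; filter; tabulate; allFin; lookup)
open import Data.List.Membership.Propositional using (_∈_; _∉_; find; lose)
open import Data.List.Membership.Propositional.Properties
  using (∈-∃++; ∈-map⁺; ∈-map⁻; ∈-++⁺ˡ; ∈-++⁺ʳ; ∈-++⁻; ∈-tabulate⁺; ∈-tabulate⁻;
         ∈-filter⁺; ∈-filter⁻; ∈-allFin)
open import Data.List.Properties
  using (++-identityʳ; length-filter; length-map; length-++; length-++-sucʳ; map-++;
         length-tabulate; map-tabulate; tabulate-lookup)
open import Data.List.Relation.Binary.Permutation.Propositional
  using (_↭_; prep; ↭-refl; ↭-trans; ↭-sym; ↭⇒↭ₛ)
open import Data.List.Relation.Binary.Permutation.Propositional.Properties
  using (shift; ↭-length; ∈-resp-↭)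
  renaming (map⁺ to map-↭)
import Data.List.Relation.Binary.Permutation.Setoid.Properties as Permutationₛ
open import Data.List.Relation.Binary.Subset.Propositional using (_⊆_)
open import Data.List.Relation.Binary.Subset.Propositional.Properties
  using (⊆∷∧∉⇒⊆; filter-⊆; ∷⁺ʳ; ∈-∷⁺ʳ; xs⊆ys++xs)
  renaming (map⁺ to map-⊆)
open import Data.List.Relation.Unary.All as All using (All; []; _∷_)
import Data.List.Relation.Unary.All.Properties as Allₚ
open import Data.List.Relation.Unary.AllPairs as AllPairs using ([]; _∷_)
open import Data.List.Relation.Unary.Any using (Any; here; there; any?)
open import Data.List.Relation.Unary.Unique.Propositional using (Unique)
import Data.List.Relation.Unary.Unique.DecPropositional as DecUnique
import Data.List.Relation.Unary.Unique.Propositional.Properties as Uniqueₚ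
open import Data.Nat.Base using (ℕ; zero; suc; _+_; _*_; _≤_; _<_; z≤n; s≤s)
open import Data.Nat.DivMod using (m/n*n≤m)
open import Data.Nat.Properties hiding (_≟_)
open import Data.Nat.Tactic.RingSolver using (solve-∀)
open import Data.Product.Base using (_×_; _,_; proj₁; proj₂; ∃-syntax; uncurry)
open import Data.Sum.Base using (_⊎_; inj₁; inj₂; [_,_]′)
open import Data.Vec.Functional using (Vector)
open import Data.Vec.Base using ([]; _∷_)
open import Function.Base using (_∘_; id)
open import Function.Definitions using (Injective)
open import Relation.Binary.PropositionalEquality
  using (_≡_; _≢_; refl; sym; trans; cong; cong₂; subst; subst₂; setoid; module ≡-Reasoning)
open import Relation.Nullary.Decidable using (Dec; yes; no; ¬?; _×-dec_; decidable-stable)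
open import Relation.Nullary.Negation using (contradiction)

-- Lists without repetition, up to permutation.

module _ {a} {A : Set a} where

  Unique-resp-↭ : ∀ {xs ys : List A} → xs ↭ ys → Unique xs → Unique ys
  Unique-resp-↭ p = Permutationₛ.Unique-resp-↭ (setoid A) (↭⇒↭ₛ p)

  ∉⇒Unique-∷ : ∀ {x} {xs : List A} → x ∉ xs → Unique xs → Unique (x ∷ xs)
  ∉⇒Unique-∷ x∉xs xs! = Allₚ.¬Any⇒All¬ _ x∉xs ∷ xs!

  -- Each element of `xs` is removed from `ys` in turn; as it does not recur in `xs`, the rest of
  -- `xs` survives the removal. The complement `zs` later provides the free rows, the free columns
  -- and the cells that are not swappable.
  Unique⊆⇒↭++ : ∀ {xs ys : List A} → Unique xs → xs ⊆ ys → ∃[ zs ] ys ↭ xs ++ zs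
  Unique⊆⇒↭++ {[]}     {ys} _ _ = ys , ↭-refl
  Unique⊆⇒↭++ {x ∷ xs} x∷xs!@(_ ∷ xs!) x∷xs⊆ys
    with as , bs , refl ← ∈-∃++ (x∷xs⊆ys (here refl)) =
    let xs⊆x∷rest : xs ⊆ x ∷ as ++ bs
        xs⊆x∷rest = ∈-resp-↭ (shift x as bs) ∘ x∷xs⊆ys ∘ there
        zs , p    = Unique⊆⇒↭++ xs! (⊆∷∧∉⇒⊆ xs⊆x∷rest (Uniqueₚ.Unique[x∷xs]⇒x∉xs x∷xs!))
    in zs , ↭-trans (shift x as bs) (prep x p)

  Unique⊆⇒length≤ : ∀ {xs ys : List A} → Unique xs → xs ⊆ ys → length xs ≤ length ys
  Unique⊆⇒length≤ {xs} xs! xs⊆ys =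
    let zs , p = Unique⊆⇒↭++ xs! xs⊆ys
    in ≤-trans (m≤m+n _ (length zs)) (≤-reflexive (sym (trans (↭-length p) (length-++ xs))))

  Unique⊆⇒↭ : ∀ {xs ys : List A} → Unique xs → xs ⊆ ys → length ys ≤ length xs → xs ↭ ys
  Unique⊆⇒↭ {xs} xs! xs⊆ys ys≤xs with Unique⊆⇒↭++ xs! xs⊆ys
  ... | []     , p = ↭-sym (subst (_ ↭_) (++-identityʳ xs) p)
  ... | z ∷ zs , p = contradiction
    (≤-trans (≤-reflexive (sym (trans (↭-length p) (length-++ xs)))) ys≤xs)
    (m+1+n≰m (length xs))

  Unique-++⇒∉ : ∀ xs {ys : List A} {x} → Unique (xs ++ ys) → x ∈ ys → x ∉ xs
  Unique-++⇒∉ (_ ∷ xs) (x∉ ∷ _)  x∈ys (here refl)  = All.lookup x∉ (∈-++⁺ʳ xs x∈ys) refl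
  Unique-++⇒∉ (_ ∷ xs) (_ ∷ xs!) x∈ys (there x∈xs) = Unique-++⇒∉ xs xs! x∈ys x∈xs

  Unique-++⁻ˡ : ∀ xs {ys : List A} → Unique (xs ++ ys) → Unique xs
  Unique-++⁻ˡ []       _              = []
  Unique-++⁻ˡ (_ ∷ xs) (x∉ ∷ xs++ys!) = Allₚ.++⁻ˡ xs x∉ ∷ Unique-++⁻ˡ xs xs++ys!

  Unique-++⁻ʳ : ∀ xs {ys : List A} → Unique (xs ++ ys) → Unique ys
  Unique-++⁻ʳ []       ys!            = ys!
  Unique-++⁻ʳ (_ ∷ xs) (_ ∷ xs++ys!) = Unique-++⁻ʳ xs xs++ys!

  Unique-tabulate⇒Injective : ∀ {n} {f : Fin n → A} → Unique (tabulate f) → Injective _≡_ _≡_ f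
  Unique-tabulate⇒Injective fs! {zero} {zero}  _  = refl
  Unique-tabulate⇒Injective (f₀∉ ∷ _) {zero}  {suc j} eq =
    contradiction eq (All.lookup f₀∉ (∈-tabulate⁺ j))
  Unique-tabulate⇒Injective (f₀∉ ∷ _) {suc i} {zero} eq =
    contradiction (sym eq) (All.lookup f₀∉ (∈-tabulate⁺ i))
  Unique-tabulate⇒Injective (_ ∷ fs!) {suc i} {suc j} eq =
    cong suc (Unique-tabulate⇒Injective fs! eq)

map-lookup : ∀ {a b} {A : Set a} {B : Set b} (f : A → B) xs → map f xs ≡ tabulate (f ∘ lookup xs)
map-lookup f xs = trans (cong (map f) (sym (tabulate-lookup xs))) (map-tabulate (lookup xs) f)

Unique-map⇒Injective : ∀ {a b} {A : Set a} {B : Set b} (f : A → B) xs → Unique (map f xs) →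
                       Injective _≡_ _≡_ (f ∘ lookup xs)
Unique-map⇒Injective f xs fxs! = Unique-tabulate⇒Injective (subst Unique (map-lookup f xs) fxs!)

-- Cancel `2 * t` on both sides. With `k` free columns, `n = t + k`.
3t<2[t+k]⇒t<2k : ∀ {t k} → 3 * t < 2 * (t + k) → t < k + k
3t<2[t+k]⇒t<2k {t} {k} = +-cancelˡ-< (2 * t) t (k + k) ∘ subst₂ _<_ (lhs t) (rhs t k)
  where
  lhs : ∀ t → 3 * t ≡ 2 * t + t
  lhs = solve-∀
  rhs : ∀ t k → 2 * (t + k) ≡ 2 * t + (k + k)
  rhs = solve-∀

-- Comparison of lists with subsets.

toSubset : ∀ {m} → List (Fin m) → Subset m
toSubset = ⋃ ∘ map ⁅_⁆

∈-toSubset⁺ : ∀ {m} {x : Fin m} {xs} → x ∈ xs → x Subset.∈ toSubset xs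
∈-toSubset⁺ (here refl)  = x∈p∪q⁺ (inj₁ (x∈⁅x⁆ _))
∈-toSubset⁺ (there x∈xs) = x∈p∪q⁺ (inj₂ (∈-toSubset⁺ x∈xs))

∈-toSubset⁻ : ∀ {m} {x : Fin m} xs → x Subset.∈ toSubset xs → x ∈ xs
∈-toSubset⁻ []       x∈ = contradiction x∈ ∉⊥
∈-toSubset⁻ (y ∷ xs) x∈ with x∈p∪q⁻ ⁅ y ⁆ (toSubset xs) x∈
... | inj₁ x∈⁅y⁆ = here (x∈⁅y⁆⇒x≡y y x∈⁅y⁆)
... | inj₂ x∈xs  = there (∈-toSubset⁻ xs x∈xs)

∣p∪q∣≤∣p∣+∣q∣ : ∀ {m} (p q : Subset m) → ∣ p ∪ q ∣ ≤ ∣ p ∣ + ∣ q ∣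
∣p∪q∣≤∣p∣+∣q∣ []            []            = z≤n
∣p∪q∣≤∣p∣+∣q∣ (outside ∷ p) (outside ∷ q) = ∣p∪q∣≤∣p∣+∣q∣ p q
∣p∪q∣≤∣p∣+∣q∣ (outside ∷ p) (inside  ∷ q) =
  ≤-trans (s≤s (∣p∪q∣≤∣p∣+∣q∣ p q)) (≤-reflexive (sym (+-suc ∣ p ∣ ∣ q ∣)))
∣p∪q∣≤∣p∣+∣q∣ (inside  ∷ p) (outside ∷ q) = s≤s (∣p∪q∣≤∣p∣+∣q∣ p q)
∣p∪q∣≤∣p∣+∣q∣ (inside  ∷ p) (inside  ∷ q) =
  s≤s (≤-trans (∣p∪q∣≤∣p∣+∣q∣ p q) (+-monoʳ-≤ ∣ p ∣ (n≤1+n ∣ q ∣)))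

∣toSubset∣≤length : ∀ {m} (xs : List (Fin m)) → ∣ toSubset xs ∣ ≤ length xs
∣toSubset∣≤length {m} []   = ≤-reflexive (∣⊥∣≡0 m)
∣toSubset∣≤length (x ∷ xs) = ≤-trans (∣p∪q∣≤∣p∣+∣q∣ ⁅ x ⁆ (toSubset xs))
  (+-mono-≤ (≤-reflexive (∣⁅x⁆∣≡1 x)) (∣toSubset∣≤length xs))

-- Each head lies outside the subset of its tail, so the cardinality rises strictly at every step.
Unique⇒length≤∣toSubset∣ : ∀ {m} {xs : List (Fin m)} → Unique xs → length xs ≤ ∣ toSubset xs ∣
Unique⇒length≤∣toSubset∣ []                            = z≤n
Unique⇒length≤∣toSubset∣ {xs = x ∷ xs} x∷xs!@(_ ∷ xs!) =
  ≤-<-trans (Unique⇒length≤∣toSubset∣ xs!) (p⊂q⇒∣p∣<∣q∣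
    ( q⊆p∪q ⁅ x ⁆ (toSubset xs) , x , x∈p∪q⁺ (inj₁ (x∈⁅x⁆ x))
    , Uniqueₚ.Unique[x∷xs]⇒x∉xs x∷xs! ∘ ∈-toSubset⁻ xs ))

-- Independence and augmentation for lists.

module IndependentLists {m} (M : Matroid m) where
  open Matroid M

  -- Distinctness makes the length of the list the cardinality of its subset, so that augmentation
  -- can compare lengths.
  IndepList : List (Fin m) → Set
  IndepList xs = Unique xs × Indep (toSubset xs)

  indepList? : ∀ xs → Dec (IndepList xs)
  indepList? xs = DecUnique.unique? _≟_ xs ×-dec indep? (toSubset xs)

  IndepList-[] : IndepList []
  IndepList-[] = [] , indep-⊥

  IndepList-⊆ : ∀ {xs ys} → Unique xs → xs ⊆ ys → IndepList ys → IndepList xs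
  IndepList-⊆ {xs} xs! xs⊆ys (_ , ys-indep) =
    xs! , hereditary (∈-toSubset⁺ ∘ xs⊆ys ∘ ∈-toSubset⁻ xs) ys-indep

  IndepList-↭ : ∀ {xs ys} → xs ↭ ys → IndepList xs → IndepList ys
  IndepList-↭ p xs-indep@(xs! , _) =
    IndepList-⊆ (Unique-resp-↭ p xs!) (∈-resp-↭ (↭-sym p)) xs-indep

  -- The count leaves `ys` no room for a further element or a repetition, so it rearranges `xs`.
  -- This carries independence from an augmented list to the list of entries that is wanted.
  IndepList-cover : ∀ {xs ys} → IndepList xs → xs ⊆ ys → length ys ≤ length xs → IndepList ys
  IndepList-cover xs-indep@(xs! , _) xs⊆ys ys≤xs =
    IndepList-↭ (Unique⊆⇒↭ xs! xs⊆ys ys≤xs) xs-indep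

  augmentList : ∀ {xs ys} → IndepList xs → IndepList ys → length xs < length ys →
                ∃[ y ] y ∈ ys × IndepList (y ∷ xs)
  augmentList {xs} {ys} (xs! , xs-indep) (ys! , ys-indep) xs<ys =
    let y , y∈ys , y∉xs , xs∪y-indep = augment xs-indep ys-indep
          (≤-<-trans (∣toSubset∣≤length xs) (<-≤-trans xs<ys (Unique⇒length≤∣toSubset∣ ys!)))
    in y , ∈-toSubset⁻ ys y∈ys , ∉⇒Unique-∷ (y∉xs ∘ ∈-toSubset⁺) xs! ,
       subst Indep (∪-comm (toSubset xs) ⁅ y ⁆) xs∪y-indep

  -- Augmentation is repeated `k` times; the room in `ys` guarantees that it never stops early.
  extendList : ∀ k {xs ys} → IndepList xs → IndepList ys → k + length xs ≤ length ys →
               ∃[ zs ] zs ⊆ ys × IndepList (zs ++ xs) × length zs ≡ k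
  extendList zero    xs-indep _        _ = [] , (λ ()) , xs-indep , refl
  extendList (suc k) {xs} xs-indep ys-indep k+xs<ys
    with zs , zs⊆ys , zs++xs-indep , refl ← extendList k xs-indep ys-indep (<⇒≤ k+xs<ys) =
    let z , z∈ys , z∷zs++xs-indep = augmentList zs++xs-indep ys-indep
          (≤-<-trans (≤-reflexive (length-++ zs)) k+xs<ys)
    in z ∷ zs , ∈-∷⁺ʳ z∈ys zs⊆ys , z∷zs++xs-indep , refl

  IndepFamily⇒IndepList : ∀ {k} (v : Vector (Fin m) k) → IndepFamily M v → IndepList (tabulate v)
  IndepFamily⇒IndepList v (v-inj , v-indep) =
    Uniqueₚ.tabulate⁺ v-inj , subst (Indep ∘ ⋃) (sym (map-tabulate v ⁅_⁆)) v-indep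

  IndepList⇒IndepFamily : ∀ {c} {C : Set c} (f : C → Fin m) xs → IndepList (map f xs) →
                          IndepFamily M (f ∘ lookup xs)
  IndepList⇒IndepFamily f xs (fxs! , fxs-indep) = Unique-map⇒Injective f xs fxs! ,
    subst (Indep ∘ ⋃)
      (trans (cong (map ⁅_⁆) (map-lookup f xs)) (map-tabulate (f ∘ lookup xs) ⁅_⁆)) fxs-indep

-- With a list of cells in place of an indexed family, adding a cell is a cons and removing one is a
-- permutation.
record PartialTransversal {m n : ℕ} (M : Matroid m) (A : Vector (Vector (Fin m) n) n)
                          (T : List (Fin n × Fin n)) : Set where
  constructor partialTransversal
  open IndependentLists M
  field
    rows!       : Unique (map proj₁ T)
    cols!       : Unique (map proj₂ T)
    independent : IndepList (map (uncurry A) T)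

-- Enlarging a partial transversal.

module Extension {m n : ℕ} (M : Matroid m) (A : Vector (Vector (Fin m) n) n)
                 (row-indep : ∀ r → IndependentLists.IndepList M (tabulate (A r))) where
  open IndependentLists M
  open import Data.List.Membership.DecPropositional (_≟_ {m}) using (_∈?_)

  Cell : Set
  Cell = Fin n × Fin n

  entry : Cell → Fin m
  entry = uncurry A

  Extensible : List Cell → Set
  Extensible T = ∃[ T′ ] PartialTransversal M A T′ × length T′ ≡ suc (length T)

  module _ {T : List Cell} (PT : PartialTransversal M A T) where
    open PartialTransversal PT

    V : List (Fin m)
    V = map entry T

    ∣V∣≡∣T∣ : length V ≡ length T
    ∣V∣≡∣T∣ = length-map entry T

    addCell : ∀ {r c} → r ∉ map proj₁ T → c ∉ map proj₂ T → IndepList (A r c ∷ V) → Extensible T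
    addCell r∉ c∉ indep = _ ,
      partialTransversal (∉⇒Unique-∷ r∉ rows!) (∉⇒Unique-∷ c∉ cols!) indep , refl

    -- Removing `d` frees its column for the cell in row `r`; the cell in row `r′` takes a free
    -- column. One cell is lost and two are gained.
    swapCell : ∀ {d T′ r r′ c′} → T ↭ d ∷ T′ → r ≢ r′ → r ∉ map proj₁ T → r′ ∉ map proj₁ T →
               c′ ∉ map proj₂ T → IndepList (A r (proj₂ d) ∷ A r′ c′ ∷ map entry T′) → Extensible T
    swapCell {d} {T′} {r} {r′} {c′} p r≢r′ r∉ r′∉ c′∉ indep
      with _ ∷ rows′! ← Unique-resp-↭ (map-↭ proj₁ p) rows!
         | d∉ ∷ cols′! ← Unique-resp-↭ (map-↭ proj₂ p) cols! =
      (r , proj₂ d) ∷ (r′ , c′) ∷ T′ ,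
      partialTransversal
        ((r≢r′ ∷ Allₚ.¬Any⇒All¬ _ (r∉ ∘ back proj₁ ∘ there)) ∷
          ∉⇒Unique-∷ (r′∉ ∘ back proj₁ ∘ there) rows′!)
        (((λ { refl → c′∉ (back proj₂ (here refl)) }) ∷ d∉) ∷
          ∉⇒Unique-∷ (c′∉ ∘ back proj₂ ∘ there) cols′!)
        indep ,
      cong suc (sym (↭-length p))
      where
      back : ∀ (f : Cell → Fin n) → map f (d ∷ T′) ⊆ map f T
      back f = ∈-resp-↭ (map-↭ f (↭-sym p))

    Swappable : Fin n → Cell → Set
    Swappable r d = IndepList (A r (proj₂ d) ∷ V)

    swappable? : ∀ r d → Dec (Swappable r d)
    swappable? r d = indepList? (A r (proj₂ d) ∷ V)

    swappableCells : Fin n → List Cell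
    swappableCells r = filter (swappable? r) T

    exchangeWith : ∀ {r r′ c′ E} → T ↭ swappableCells r ++ E →
                   r ≢ r′ → r ∉ map proj₁ T → r′ ∉ map proj₁ T → c′ ∉ map proj₂ T →
                   IndepList (A r′ c′ ∷ map entry E) → length E < length T → Extensible T
    exchangeWith {r} {r′} {c′} {E} T↭H++E r≢r′ r∉ r′∉ c′∉ x∷E-indep ∣E∣<∣T∣
      -- Here `k` is the number of members of `V` needed to fill `x ∷ map entry E` up to the length
      -- of `T`.
      with k , 1+∣E∣+k≡∣T∣ ← m≤n⇒∃[o]m+o≡n ∣E∣<∣T∣
      with zs , zs⊆V , J-indep , refl ← extendList k x∷E-indep independent (≤-reflexive
             (trans (cong ((k +_) ∘ suc) (length-map entry E))
               (trans (+-comm k _) (trans 1+∣E∣+k≡∣T∣ (sym ∣V∣≡∣T∣))))) =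
      go (any? outside? T)
      where
      x = A r′ c′
      J = zs ++ x ∷ map entry E

      -- `x` is left out of the list because it may itself be an entry of `T`. The cell with that
      -- entry can still be the one given up, since the new cell in row `r′` supplies `x` again.
      Outside : Cell → Set
      Outside d = entry d ∉ zs ++ map entry E

      outside? : ∀ d → Dec (Outside d)
      outside? d = ¬? (entry d ∈? zs ++ map entry E)

      E⊆V : map entry E ⊆ V
      E⊆V = map-⊆ entry (∈-resp-↭ (↭-sym T↭H++E) ∘ ∈-++⁺ʳ (swappableCells r))

      zs++E⊆V : zs ++ map entry E ⊆ V
      zs++E⊆V = [ zs⊆V , E⊆V ]′ ∘ ∈-++⁻ zs

      ∣J∣≡∣T∣ : length J ≡ length T
      ∣J∣≡∣T∣ = begin
        length J                                ≡⟨ length-++ zs ⟩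
        length zs + suc (length (map entry E))  ≡⟨ cong ((length zs +_) ∘ suc) (length-map entry E) ⟩
        length zs + suc (length E)              ≡⟨ +-comm (length zs) _ ⟩
        suc (length E) + length zs              ≡⟨ 1+∣E∣+k≡∣T∣ ⟩
        length T                                ∎
        where open ≡-Reasoning

      ∣zs++E∣<∣V∣ : length (zs ++ map entry E) < length V
      ∣zs++E∣<∣V∣ = ≤-reflexive
        (trans (sym (length-++-sucʳ zs x (map entry E))) (trans ∣J∣≡∣T∣ (sym ∣V∣≡∣T∣)))

      J⊆ : ∀ {ys} → zs ++ map entry E ⊆ ys → J ⊆ x ∷ ys
      J⊆ zs++E⊆ys = ∷⁺ʳ x zs++E⊆ys ∘ ∈-resp-↭ (shift x zs (map entry E))

      -- A member of V that augments J makes J plus it as large as x ∷ V, so x extends V.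
      go : Dec (Any Outside T) → Extensible T
      -- Otherwise all of `V`, which has no repetitions, would lie in a list shorter than itself.
      go (no none) = contradiction
        (Unique⊆⇒length≤ (proj₁ independent) λ v∈V → let d , d∈T , v≡ = ∈-map⁻ entry v∈V in
          subst (_∈ zs ++ map entry E) (sym v≡)
            (decidable-stable (entry d ∈? zs ++ map entry E) (none ∘ lose d∈T)))
        (<⇒≱ ∣zs++E∣<∣V∣)
      go (yes some) with d , d∈T , d∉ ← find some
        with T′ , T↭d∷T′ ← Unique⊆⇒↭++ {xs = d ∷ []} ([] ∷ []) (λ { (here refl) → d∈T })
        with ∈-++⁻ (swappableCells r) (∈-resp-↭ T↭H++E d∈T)
      ... | inj₂ d∈E = contradiction (∈-++⁺ʳ zs (∈-map⁺ entry d∈E)) d∉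
      ... | inj₁ d∈H
        -- As `d` is swappable, `V` together with the entry of row `r` in the column of `d` is
        -- independent and one longer than `J`.
        with augmentList J-indep (proj₂ (∈-filter⁻ (swappable? r) {xs = T} d∈H))
               (s≤s (≤-reflexive (trans ∣J∣≡∣T∣ (sym ∣V∣≡∣T∣))))
      ... | z , there z∈V , z∷J-indep = addCell r′∉ c′∉
        (IndepList-cover z∷J-indep (∈-∷⁺ʳ (there z∈V) (J⊆ zs++E⊆V))
          (s≤s (≤-reflexive (trans ∣V∣≡∣T∣ (sym ∣J∣≡∣T∣)))))
      -- Apart from `x`, the list `J` consists of entries of `T` and avoids that of `d`, so it lies
      -- in `x ∷ map entry T′`, and the lengths agree.
      ... | _ , here refl , y∷J-indep = swapCell T↭d∷T′ r≢r′ r∉ r′∉ c′∉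
        (IndepList-cover y∷J-indep (∷⁺ʳ _ (J⊆ zs++E⊆T′)) (s≤s (≤-reflexive
          (trans (cong suc (length-map entry T′)) (trans (sym (↭-length T↭d∷T′)) (sym ∣J∣≡∣T∣))))))
        where
        zs++E⊆T′ : zs ++ map entry E ⊆ map entry T′
        zs++E⊆T′ = ⊆∷∧∉⇒⊆ (∈-resp-↭ (map-↭ entry T↭d∷T′) ∘ zs++E⊆V) d∉

    -- Counting free lines and swappable cells; `f` selects rows or columns.

    ∣T∣+∣free∣≡n : ∀ (f : Cell → Fin n) {F} → allFin n ↭ map f T ++ F → length T + length F ≡ n
    ∣T∣+∣free∣≡n f {F} F-free = begin
      length T + length F          ≡⟨ cong (_+ length F) (length-map f T) ⟨
      length (map f T) + length F  ≡⟨ length-++ (map f T) ⟨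
      length (map f T ++ F)        ≡⟨ ↭-length F-free ⟨
      length (allFin n)            ≡⟨ length-tabulate id ⟩
      n                            ∎
      where open ≡-Reasoning

    free! : ∀ (f : Cell → Fin n) {F} → allFin n ↭ map f T ++ F → Unique (map f T ++ F)
    free! f F-free = Unique-resp-↭ F-free (Uniqueₚ.allFin⁺ n)

    ∈free⇒∉ : ∀ (f : Cell → Fin n) {F x} → allFin n ↭ map f T ++ F → x ∈ F → x ∉ map f T
    ∈free⇒∉ f F-free = Unique-++⇒∉ (map f T) (free! f F-free)

    module _ {FC : List (Fin n)} (FC-free : allFin n ↭ map proj₂ T ++ FC) where

      -- Row `r` has `length T + length FC` independent entries, so `length FC` of them can be added
      -- to `V` together, and hence each can be added alone. If no entry in a free column can be
      -- added, all of these lie in columns of `T`, and their distinctness gives as many swappable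
      -- cells.
      manySwappable : ∀ {r} → r ∉ map proj₁ T →
                      Extensible T ⊎ length FC ≤ length (swappableCells r)
      manySwappable {r} r∉ with any? (λ c → indepList? (A r c ∷ V)) FC
      ... | yes p =
        let c , c∈FC , indep = find p in inj₁ (addCell r∉ (∈free⇒∉ proj₂ FC-free c∈FC) indep)
      ... | no ¬free
        with zs , zs⊆row , zs++V-indep@(zs++V! , _) , ∣zs∣≡∣FC∣
          ← extendList (length FC) independent (row-indep r) (≤-reflexive
              (trans (cong (length FC +_) ∣V∣≡∣T∣) (trans (+-comm (length FC) (length T))
                (trans (∣T∣+∣free∣≡n proj₂ FC-free) (sym (length-tabulate (A r))))))) =
        inj₂ (begin
          length FC                      ≡⟨ ∣zs∣≡∣FC∣ ⟨
          length zs                      ≤⟨ Unique⊆⇒length≤ (Unique-++⁻ˡ zs zs++V!) zs⊆ ⟩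
          length (map (A r ∘ proj₂) H)   ≡⟨ length-map (A r ∘ proj₂) H ⟩
          length H                       ∎)
        where
        open ≤-Reasoning
        H = swappableCells r

        z∷V-indep : ∀ {z} → z ∈ zs → IndepList (z ∷ V)
        z∷V-indep z∈zs = IndepList-⊆
          (∉⇒Unique-∷ (λ z∈V → Unique-++⇒∉ zs zs++V! z∈V z∈zs) (Unique-++⁻ʳ zs zs++V!))
          (∈-∷⁺ʳ (∈-++⁺ˡ z∈zs) (xs⊆ys++xs V zs)) zs++V-indep

        zs⊆ : zs ⊆ map (A r ∘ proj₂) H
        zs⊆ z∈zs with c , refl ← ∈-tabulate⁻ (zs⊆row z∈zs)
          with ∈-++⁻ (map proj₂ T) (∈-resp-↭ FC-free (∈-allFin c))
        ... | inj₂ c∈FC = contradiction (lose c∈FC (z∷V-indep z∈zs)) ¬free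
        ... | inj₁ c∈cols with d , d∈T , refl ← ∈-map⁻ proj₂ c∈cols =
          ∈-map⁺ (A r ∘ proj₂) (∈-filter⁺ (swappable? r) d∈T (z∷V-indep z∈zs))

      -- The bounds leave fewer than `length FC` cells in `E`, while row `r′` has `length FC`
      -- independent entries in free columns. One of these therefore augments the entries of `E`.
      exchange : ∀ {r r′} → r ≢ r′ → r ∉ map proj₁ T → r′ ∉ map proj₁ T →
                 length FC ≤ length (swappableCells r) → length T < length FC + length FC →
                 Extensible T
      exchange {r} {r′} r≢r′ r∉ r′∉ FC≤H T<2FC
        with E , T↭H++E ← Unique⊆⇒↭++ (Uniqueₚ.filter⁺ (swappable? r) (Uniqueₚ.map⁻ rows!))
                                      (filter-⊆ (swappable? r) T) =
        let x , x∈X , x∷E-indep = augmentList E-indep X-indep ∣E∣<∣X∣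
            c′ , c′∈FC , x≡ = ∈-map⁻ (A r′) x∈X
        in exchangeWith T↭H++E r≢r′ r∉ r′∉ (∈free⇒∉ proj₂ FC-free c′∈FC)
             (subst (λ x → IndepList (x ∷ map entry E)) x≡ x∷E-indep) ∣E∣<∣T∣
        where
        H = swappableCells r

        E⊆T : E ⊆ T
        E⊆T = ∈-resp-↭ (↭-sym T↭H++E) ∘ ∈-++⁺ʳ H

        E-indep : IndepList (map entry E)
        E-indep = IndepList-⊆
          (Unique-++⁻ʳ (map entry H) (subst Unique (map-++ entry H E)
            (Unique-resp-↭ (map-↭ entry T↭H++E) (proj₁ independent))))
          (map-⊆ entry E⊆T) independent

        X-indep : IndepList (map (A r′) FC)
        X-indep = IndepList-⊆ (Uniqueₚ.map⁺ (Unique-tabulate⇒Injective (proj₁ (row-indep r′)))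
            (Unique-++⁻ʳ (map proj₂ T) (free! proj₂ FC-free)))
          (λ x∈X → let c , _ , x≡ = ∈-map⁻ (A r′) x∈X
                   in subst (_∈ tabulate (A r′)) (sym x≡) (∈-tabulate⁺ c))
          (row-indep r′)

        ∣H∣+∣E∣≡∣T∣ : length H + length E ≡ length T
        ∣H∣+∣E∣≡∣T∣ = sym (trans (↭-length T↭H++E) (length-++ H))

        ∣E∣<∣FC∣ : length E < length FC
        ∣E∣<∣FC∣ = +-cancelˡ-< (length FC) _ _ (begin-strict
          length FC + length E   ≤⟨ +-monoˡ-≤ (length E) FC≤H ⟩
          length H + length E    ≡⟨ ∣H∣+∣E∣≡∣T∣ ⟩
          length T               <⟨ T<2FC ⟩
          length FC + length FC  ∎)
          where open ≤-Reasoning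

        ∣E∣<∣X∣ : length (map entry E) < length (map (A r′) FC)
        ∣E∣<∣X∣ = begin-strict
          length (map entry E)    ≡⟨ length-map entry E ⟩
          length E                <⟨ ∣E∣<∣FC∣ ⟩
          length FC               ≡⟨ length-map (A r′) FC ⟨
          length (map (A r′) FC)  ∎
          where open ≤-Reasoning

        ∣E∣<∣T∣ : length E < length T
        ∣E∣<∣T∣ = begin-strict
          length E             <⟨ ∣E∣<∣FC∣ ⟩
          length FC            ≤⟨ FC≤H ⟩
          length H             ≤⟨ m≤m+n (length H) (length E) ⟩
          length H + length E  ≡⟨ ∣H∣+∣E∣≡∣T∣ ⟩
          length T             ∎
          where open ≤-Reasoning

  -- There are as many free rows as free columns, and the size bound makes that number positive.
  -- Outside the excluded degree, a second free row exists whenever the exchange is required.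
  extend : n ≢ 2 → ∀ {T} → PartialTransversal M A T → 3 * length T < 2 * n → Extensible T
  extend n≢2 {T} PT 3t<2n
    with FR , FR-free ← Unique⊆⇒↭++ (PartialTransversal.rows! PT) (λ {r} _ → ∈-allFin r)
       | FC , FC-free ← Unique⊆⇒↭++ (PartialTransversal.cols! PT) (λ {c} _ → ∈-allFin c) =
    go FR FR-free
    where
    t+k≡n : length T + length FC ≡ n
    t+k≡n = ∣T∣+∣free∣≡n PT proj₂ FC-free

    t<2k : length T < length FC + length FC
    t<2k = 3t<2[t+k]⇒t<2k (<-≤-trans 3t<2n (≤-reflexive (cong (2 *_) (sym t+k≡n))))

    go : ∀ FR → allFin n ↭ map proj₁ T ++ FR → Extensible T
    go FR FR-free
      with +-cancelˡ-≡ (length T) _ _ (trans (∣T∣+∣free∣≡n PT proj₁ FR-free) (sym t+k≡n))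
    go [] FR-free | 0≡k = contradiction (subst (λ k → length T < k + k) (sym 0≡k) t<2k) λ ()
    go (r ∷ FR′) FR-free | ∣FR∣≡k
      with manySwappable PT FC-free (∈free⇒∉ PT proj₁ FR-free (here refl))
    go (r ∷ FR′) FR-free | ∣FR∣≡k | inj₁ extensible = extensible
    go (r ∷ r′ ∷ _) FR-free | _ | inj₂ k≤∣H∣ = exchange PT FC-free
      (All.head (AllPairs.head (Unique-++⁻ʳ (map proj₁ T) (free! PT proj₁ FR-free))))
      (∈free⇒∉ PT proj₁ FR-free (here refl)) (∈free⇒∉ PT proj₁ FR-free (there (here refl)))
      k≤∣H∣ t<2k
    -- With one free row, `T` has fewer than two cells, and the swappable cell shows that it has
    -- one; thus `n` is 2.
    go (r ∷ []) FR-free | 1≡k | inj₂ k≤∣H∣ = contradiction n≡2 n≢2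
      where
      k≤t : length FC ≤ length T
      k≤t = ≤-trans k≤∣H∣ (length-filter (swappable? PT r) T)

      t≡1 : length T ≡ 1
      t≡1 = ≤-antisym (≤-pred (subst (λ k → length T < k + k) (sym 1≡k) t<2k))
                      (subst (_≤ length T) (sym 1≡k) k≤t)

      n≡2 : n ≡ 2
      n≡2 = trans (sym t+k≡n) (cong₂ _+_ t≡1 (sym 1≡k))

  -- Induction on `k`, starting from the empty transversal. The bound is the division-free form of
  -- `k ≤ ⌈ 2 * n / 3 ⌉`; for `suc k` it says exactly that `3 * k < 2 * n`, the hypothesis of
  -- `extend`.
  partialTransversalOfLength : n ≢ 2 → ∀ k → 3 * k ≤ 2 * n + 2 →
                               ∃[ T ] PartialTransversal M A T × length T ≡ k
  partialTransversalOfLength n≢2 zero    _    = [] , partialTransversal [] [] IndepList-[] , refl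
  partialTransversalOfLength n≢2 (suc k) 3+3k≤2n+2
    with T , PT , refl ← partialTransversalOfLength n≢2 k
           (≤-trans (*-monoʳ-≤ 3 (n≤1+n k)) 3+3k≤2n+2) =
    extend n≢2 PT (+-cancelʳ-≤ 2 _ _ (begin
      suc (3 * length T) + 2  ≡⟨ +-comm (suc (3 * length T)) 2 ⟩
      3 + 3 * length T        ≡⟨ *-suc 3 (length T) ⟨
      3 * suc (length T)      ≤⟨ 3+3k≤2n+2 ⟩
      2 * n + 2               ∎))
    where open ≤-Reasoning

-- Return to indexed transversals, and the theorem.

fromPartialTransversal : ∀ {m n} {M : Matroid m} {A : Vector (Vector (Fin m) n) n} {T} →
                         PartialTransversal M A T → IndepPartialTransversal M A (length T)
fromPartialTransversal {M = M} {A} {T} PT = record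
  { row         = proj₁ ∘ lookup T
  ; col         = proj₂ ∘ lookup T
  ; row-inj     = Unique-map⇒Injective proj₁ T rows!
  ; col-inj     = Unique-map⇒Injective proj₂ T cols!
  ; independent = IndependentLists.IndepList⇒IndepFamily M (uncurry A) T independent
  }
  where open PartialTransversal PT

theorem2p2 : ∀ {m n : ℕ} (M : Matroid m) (A : Vector (Vector (Fin m) n) n) →
    n ≢ 2 →
    IsMLS M A →
    IndepPartialTransversal M A ⌈ 2 * n / 3 ⌉
theorem2p2 {n = n} M A n≢2 mls =
  let T , PT , ∣T∣≡ = partialTransversalOfLength n≢2 ⌈ 2 * n / 3 ⌉
        -- The ceiling is the floor of `2 * n + 2` divided by 3, so three times it is at most
        -- `2 * n + 2`.
        (≤-trans (≤-reflexive (*-comm 3 ⌈ 2 * n / 3 ⌉)) (m/n*n≤m (2 * n + 2) 3))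
  in subst (IndepPartialTransversal M A) ∣T∣≡ (fromPartialTransversal PT)
  where
  row-indep : ∀ r → IndependentLists.IndepList M (tabulate (A r))
  row-indep r = let A-inj , A-indep , _ = IsMLS.rows mls r
                in IndependentLists.IndepFamily⇒IndepList M (A r) (A-inj , A-indep)

  open Extension M A row-indep
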